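{- Let $R$ be a finite Frobenius ring, let $V=R^n$, and let $G$ be a finite permutation group on the coordinates of $V$. Let $H$ be a subgroup of $G$ such that $|H|$ has an inverse in $R$, and define the operator $\theta_H := \frac{1}{|H|}\sum_{h\in H} h$ on $V$. If $C$ is a left $G$-code of length $n$ over $R$, then $${}^{\perp}(C\theta_H) = \ker\theta_H \oplus ({}^{\perp}C)\theta_H .$$
   Context: A finite (associative, unital) ring $R$ is Frobenius if $R/\mathrm{Rad}(R)\cong \mathrm{Soc}(R_R)$ as right $R$-modules and $R/\mathrm{Rad}(R)\cong\mathrm{Soc}({}_RR)$ as left $R$-modules. $R$ need not be commutative. On $V=R^n$ put $(u,v):=u_1v_1+\cdots+u_nv_n$. A permutation group $G$ on the coordinate set $\{1,\dots,n\}$ acts on $V$ on the right by $(vg)_i = v_{ig^{ -1}}$. A left $G$-code of length $n$ over $R$ is a left $R$-submodule $C$ of $V$ with $Cg\subseteq C$ for all $g\in G$. "$|H|$ has an inverse in $R$" means $|H|\cdot 1_R$ is a unit. For $v\in V$, $v\theta_H=\frac1{|H|}\sum_{h\in H}vh$; for $X\subseteq V$, $X\theta_H=\{v\theta_H: v\in X\}$; $\ker\theta_H=\{v\in V: v\theta_H=0\}$. For a submodule $X\subseteq V$, ${}^{\perp}X:=\{u\in V: (u,v)=0 \text{ for all } v\in X\}$. The sum is an internal direct sum inside $V$. -}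

module Defs where

open import Algebra.Bundles using (Ring; AbelianGroup)
open import Algebra.Definitions using (Invertible)
import Algebra.Construct.Pointwise as Pointwise
import Algebra.Definitions.RawMonoid as RawMonoidDefs
open import Algebra.Module.Bundles using (LeftModule; RightModule)
import Algebra.Module.Construct.TensorUnit as TensorUnit
import Algebra.Module.Morphism.LeftModuleMonomorphism as LeftMono
import Algebra.Module.Morphism.RightModuleMonomorphism as RightMono
open import Algebra.Module.Morphism.Structures using (module LeftModuleMorphisms; module RightModuleMorphisms)
import Algebra.Properties.AbelianGroup as AbelianGroupProperties
import Algebra.Properties.Ring as RingProperties
open import Algebra.Structures using (IsAbelianGroup)
open import Data.Fin.Base using (Fin)
import Data.Fin.Permutation as Perm
open Perm using (Permutation′; _⟨$⟩ˡ_; _∘ₚ_)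
open import Data.Nat.Base using (ℕ)
open import Data.Product.Base using (Σ; ∃; ∃₂; ∃-syntax; _×_; _,_; proj₁; proj₂)
open import Data.Vec.Functional using (Vector)
open import Function.Base using (flip)
open import Function.Bundles using (Inverse)
open import Level using (Level; _⊔_; suc)
open import Relation.Binary.Bundles using (Setoid)
open import Relation.Binary.Core using (Rel)
import Relation.Binary.Construct.On as On
open import Relation.Binary.Definitions using (_Respects_)
open import Relation.Binary.PropositionalEquality as ≡ using ()
open import Relation.Binary.Structures using (IsEquivalence)
import Relation.Binary.Reasoning.Setoid as SetoidReasoning
open import Relation.Nullary.Negation using (¬_)
open import Relation.Unary using (Pred; _∈_; _∉_; _⊆_; _≐_; Universal)

record IsFinite {a ℓ} (S : Setoid a ℓ) : Set (a ⊔ ℓ) where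
  field
    size        : ℕ
    enumeration : Inverse S (≡.setoid (Fin size))

-- Submodules of an abelian group A with a set S of operators.  It is used
-- below with `act` the scaling of a left module and with `act` the (flipped)
-- scaling of a right module, so that both sides share the same definitions.
module Submodules {r m ℓ} {S : Set r} (A : AbelianGroup m ℓ)
                  (act : S → AbelianGroup.Carrier A → AbelianGroup.Carrier A) where

  open AbelianGroup A renaming (_∙_ to _+_; ε to 0#; _⁻¹ to -_)
  private module A = AbelianGroupProperties A

  record IsSubmodule {p} (X : Pred Carrier p) : Set (r ⊔ m ⊔ ℓ ⊔ p) where
    field
      resp       : X Respects _≈_
      0-closed   : 0# ∈ X
      +-closed   : ∀ {x y} → x ∈ X → y ∈ X → x + y ∈ X
      neg-closed : ∀ {x} → x ∈ X → - x ∈ X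
      act-closed : ∀ s {x} → x ∈ X → act s x ∈ X

  -- Here and in `IsSimple`, the competing submodules Y have the same universe
  -- level as X.  The ring-theoretic notions below use the level c ⊔ ℓ, at which
  -- all finitely generated ideals live.
  record IsMaximal {p} (X : Pred Carrier p) : Set (r ⊔ m ⊔ ℓ ⊔ suc p) where
    field
      isSubmodule : IsSubmodule X
      proper      : ¬ Universal X
      maximal     : ∀ {Y : Pred Carrier p} → IsSubmodule Y →
                    X ⊆ Y → ¬ Universal Y → Y ⊆ X

  record IsSimple {p} (X : Pred Carrier p) : Set (r ⊔ m ⊔ ℓ ⊔ suc p) where
    field
      isSubmodule : IsSubmodule X
      nonzero     : ∃[ x ] x ∈ X × ¬ x ≈ 0#
      minimal     : ∀ {Y : Pred Carrier p} → IsSubmodule Y →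
                    Y ⊆ X → (∃[ y ] y ∈ Y × ¬ y ≈ 0#) → X ⊆ Y

  -- The sum of all simple submodules: the finite sums of elements each lying
  -- in some simple submodule.
  data Socle : Pred Carrier (suc (r ⊔ m ⊔ ℓ)) where
    simple : ∀ {X : Pred Carrier (r ⊔ m ⊔ ℓ)} {x} → IsSimple X → x ∈ X → x ∈ Socle
    zero   : 0# ∈ Socle
    plus   : ∀ {x y} → x ∈ Socle → y ∈ Socle → x + y ∈ Socle
    equal  : ∀ {x y} → x ≈ y → x ∈ Socle → y ∈ Socle

  -- P is the internal direct sum X ⊕ Y of submodules of A.
  record IsInternalDirectSum {p x y} (P : Pred Carrier p) (X : Pred Carrier x) (Y : Pred Carrier y)
                             : Set (r ⊔ m ⊔ ℓ ⊔ p ⊔ x ⊔ y) where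
    field
      isSubmoduleˡ : IsSubmodule X
      isSubmoduleʳ : IsSubmodule Y
      isSum        : P ≐ (λ z → ∃₂ λ a b → a ∈ X × b ∈ Y × z ≈ a + b)
      independent  : ∀ {z} → z ∈ X → z ∈ Y → z ≈ 0#

  module _ {p} {X : Pred Carrier p} (X-sub : IsSubmodule X) where

    open IsSubmodule X-sub

    infix 4 _∼_
    _∼_ : Rel Carrier p
    x ∼ y = x - y ∈ X

    ≈⇒∼ : ∀ {x y} → x ≈ y → x ∼ y
    ≈⇒∼ x≈y = resp (sym (A.x≈y⇒x∙y⁻¹≈ε x≈y)) 0-closed

    private
      open SetoidReasoning setoid

      neg-diff : ∀ x y → - (x - y) ≈ y - x
      neg-diff = A.⁻¹-anti-homo-//

      telescope : ∀ x y z → (x - y) + (y - z) ≈ x - z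
      telescope x y z = begin
        (x - y) + (y - z)     ≈⟨ assoc x (- y) (y - z) ⟩
        x + (- y + (y - z))   ≈⟨ ∙-congˡ (assoc (- y) y (- z)) ⟨
        x + ((- y + y) - z)   ≈⟨ ∙-congˡ (∙-congʳ (inverseˡ y)) ⟩
        x + (0# - z)          ≈⟨ ∙-congˡ (identityˡ (- z)) ⟩
        x - z                 ∎

      interchange : ∀ x y u v → (x - y) + (u - v) ≈ (x + u) - (y + v)
      interchange x y u v = begin
        (x - y) + (u - v)       ≈⟨ assoc x (- y) (u - v) ⟩
        x + (- y + (u - v))     ≈⟨ ∙-congˡ (assoc (- y) u (- v)) ⟨
        x + ((- y + u) - v)     ≈⟨ ∙-congˡ (∙-congʳ (comm (- y) u)) ⟩
        x + ((u - y) - v)       ≈⟨ ∙-congˡ (assoc u (- y) (- v)) ⟩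
        x + (u + (- y - v))     ≈⟨ ∙-congˡ (∙-congˡ (A.⁻¹-∙-comm y v)) ⟩
        x + (u - (y + v))       ≈⟨ assoc x u (- (y + v)) ⟨
        (x + u) - (y + v)       ∎

    ∼-isEquivalence : IsEquivalence _∼_
    ∼-isEquivalence = record
      { refl  = ≈⇒∼ refl
      ; sym   = λ {x} {y} d → resp (neg-diff x y) (neg-closed d)
      ; trans = λ {x} {y} {z} d e → resp (telescope x y z) (+-closed d e)
      }

    ∼-isAbelianGroup : IsAbelianGroup _∼_ _+_ 0# (λ x → - x)
    ∼-isAbelianGroup = record
      { isGroup = record
        { isMonoid = record
          { isSemigroup = record
            { isMagma = record
              { isEquivalence = ∼-isEquivalence
              ; ∙-cong = λ {x} {y} {u} {v} d e → resp (interchange x y u v) (+-closed d e)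
              }
            ; assoc = λ x y z → ≈⇒∼ (assoc x y z)
            }
          ; identity = (λ x → ≈⇒∼ (identityˡ x)) , (λ x → ≈⇒∼ (identityʳ x))
          }
        ; inverse = (λ x → ≈⇒∼ (inverseˡ x)) , (λ x → ≈⇒∼ (inverseʳ x))
        ; ⁻¹-cong = λ {x} {y} d → resp (sym (A.⁻¹-∙-comm x (- y))) (neg-closed d)
        }
      ; comm = λ x y → ≈⇒∼ (comm x y)
      }

module _ {c ℓ} {R : Ring c ℓ} where

  open Ring R using (isRing)

  module LeftSubmodules {m ℓm} (M : LeftModule R m ℓm) =
    Submodules (LeftModule.+ᴹ-abelianGroup M) (LeftModule._*ₗ_ M)

  module RightSubmodules {m ℓm} (M : RightModule R m ℓm) =
    Submodules (RightModule.+ᴹ-abelianGroup M) (flip (RightModule._*ᵣ_ M))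

  infix 4 _≅ₗ_ _≅ᵣ_

  _≅ₗ_ : ∀ {m ℓm n ℓn} → LeftModule R m ℓm → LeftModule R n ℓn → Set _
  M ≅ₗ N = ∃ (LeftModuleMorphisms.IsLeftModuleIsomorphism
                (LeftModule.rawLeftModule M) (LeftModule.rawLeftModule N))

  _≅ᵣ_ : ∀ {m ℓm n ℓn} → RightModule R m ℓm → RightModule R n ℓn → Set _
  M ≅ᵣ N = ∃ (RightModuleMorphisms.IsRightModuleIsomorphism
                (RightModule.rawRightModule M) (RightModule.rawRightModule N))

  module _ {m ℓm p} (M : LeftModule R m ℓm) {X : Pred (LeftModule.Carrierᴹ M) p} where

    open LeftModule M
    open LeftSubmodules M
    open AbelianGroupProperties +ᴹ-abelianGroup using (inverseʳ-unique)

    leftSubmodule : IsSubmodule X → LeftModule R (m ⊔ p) ℓm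
    leftSubmodule X-sub = record
      { Carrierᴹ     = Σ Carrierᴹ X
      ; _≈ᴹ_         = λ x y → proj₁ x ≈ᴹ proj₁ y
      ; _+ᴹ_         = λ x y → proj₁ x +ᴹ proj₁ y , +-closed (proj₂ x) (proj₂ y)
      ; _*ₗ_         = λ s x → s *ₗ proj₁ x , act-closed s (proj₂ x)
      ; 0ᴹ           = 0ᴹ , 0-closed
      ; -ᴹ_          = λ x → -ᴹ proj₁ x , neg-closed (proj₂ x)
      ; isLeftModule = LeftMono.isLeftModule {N = rawLeftModule} {⟦_⟧ = proj₁} (record
          { isLeftModuleHomomorphism = record
            { +ᴹ-isGroupHomomorphism = record
              { isMonoidHomomorphism = record
                { isMagmaHomomorphism = record
                  { isRelHomomorphism = record { cong = λ eq → eq }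
                  ; homo = λ _ _ → ≈ᴹ-refl }
                ; ε-homo = ≈ᴹ-refl }
              ; ⁻¹-homo = λ _ → ≈ᴹ-refl }
            ; *ₗ-homo = λ _ _ → ≈ᴹ-refl }
          ; injective = λ eq → eq }) isRing isLeftModule
      } where open IsSubmodule X-sub

    leftQuotient : IsSubmodule X → LeftModule R m p
    leftQuotient X-sub = record
      { Carrierᴹ     = Carrierᴹ
      ; _≈ᴹ_         = _∼_ X-sub
      ; _+ᴹ_         = _+ᴹ_
      ; _*ₗ_         = _*ₗ_
      ; 0ᴹ           = 0ᴹ
      ; -ᴹ_          = -ᴹ_
      ; isLeftModule = record
        { isLeftSemimodule = record
          { +ᴹ-isCommutativeMonoid = IsAbelianGroup.isCommutativeMonoid Q
          ; isPreleftSemimodule = record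
            { *ₗ-cong      = λ {s} {t} {x} {y} s≈t d → resp
                (≈ᴹ-trans (*ₗ-distribˡ s x (-ᴹ y))
                  (+ᴹ-cong ≈ᴹ-refl (≈ᴹ-trans (*ₗ-neg s y) (-ᴹ‿cong (*ₗ-cong s≈t ≈ᴹ-refl)))))
                (act-closed s d)
            ; *ₗ-zeroˡ     = λ x → ≈⇒∼ X-sub (*ₗ-zeroˡ x)
            ; *ₗ-distribʳ  = λ x s t → ≈⇒∼ X-sub (*ₗ-distribʳ x s t)
            ; *ₗ-identityˡ = λ x → ≈⇒∼ X-sub (*ₗ-identityˡ x)
            ; *ₗ-assoc     = λ s t x → ≈⇒∼ X-sub (*ₗ-assoc s t x)
            ; *ₗ-zeroʳ     = λ s → ≈⇒∼ X-sub (*ₗ-zeroʳ s)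
            ; *ₗ-distribˡ  = λ s x y → ≈⇒∼ X-sub (*ₗ-distribˡ s x y)
            }
          }
        ; -ᴹ‿cong    = IsAbelianGroup.⁻¹-cong Q
        ; -ᴹ‿inverse = IsAbelianGroup.inverse Q
        }
      } where
        open IsSubmodule X-sub
        Q = ∼-isAbelianGroup X-sub
        *ₗ-neg : ∀ s x → s *ₗ (-ᴹ x) ≈ᴹ -ᴹ (s *ₗ x)
        *ₗ-neg s x = inverseʳ-unique (s *ₗ x) (s *ₗ (-ᴹ x))
          (≈ᴹ-trans (≈ᴹ-sym (*ₗ-distribˡ s x (-ᴹ x)))
            (≈ᴹ-trans (*ₗ-cong (Ring.refl R) (-ᴹ‿inverseʳ x)) (*ₗ-zeroʳ s)))

  module _ {m ℓm p} (M : RightModule R m ℓm) {X : Pred (RightModule.Carrierᴹ M) p} where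

    open RightModule M
    open RightSubmodules M
    open AbelianGroupProperties +ᴹ-abelianGroup using (inverseʳ-unique)

    rightSubmodule : IsSubmodule X → RightModule R (m ⊔ p) ℓm
    rightSubmodule X-sub = record
      { Carrierᴹ      = Σ Carrierᴹ X
      ; _≈ᴹ_          = λ x y → proj₁ x ≈ᴹ proj₁ y
      ; _+ᴹ_          = λ x y → proj₁ x +ᴹ proj₁ y , +-closed (proj₂ x) (proj₂ y)
      ; _*ᵣ_          = λ x s → proj₁ x *ᵣ s , act-closed s (proj₂ x)
      ; 0ᴹ            = 0ᴹ , 0-closed
      ; -ᴹ_           = λ x → -ᴹ proj₁ x , neg-closed (proj₂ x)
      ; isRightModule = RightMono.isRightModule {N = rawRightModule} {⟦_⟧ = proj₁} (record
          { isRightModuleHomomorphism = record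
            { +ᴹ-isGroupHomomorphism = record
              { isMonoidHomomorphism = record
                { isMagmaHomomorphism = record
                  { isRelHomomorphism = record { cong = λ eq → eq }
                  ; homo = λ _ _ → ≈ᴹ-refl }
                ; ε-homo = ≈ᴹ-refl }
              ; ⁻¹-homo = λ _ → ≈ᴹ-refl }
            ; *ᵣ-homo = λ _ _ → ≈ᴹ-refl }
          ; injective = λ eq → eq }) isRing isRightModule
      } where open IsSubmodule X-sub

    rightQuotient : IsSubmodule X → RightModule R m p
    rightQuotient X-sub = record
      { Carrierᴹ      = Carrierᴹ
      ; _≈ᴹ_          = _∼_ X-sub
      ; _+ᴹ_          = _+ᴹ_
      ; _*ᵣ_          = _*ᵣ_
      ; 0ᴹ            = 0ᴹ
      ; -ᴹ_           = -ᴹ_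
      ; isRightModule = record
        { isRightSemimodule = record
          { +ᴹ-isCommutativeMonoid = IsAbelianGroup.isCommutativeMonoid Q
          ; isPrerightSemimodule = record
            { *ᵣ-cong      = λ {x} {y} {s} {t} d s≈t → resp
                (≈ᴹ-trans (*ᵣ-distribʳ s x (-ᴹ y))
                  (+ᴹ-cong ≈ᴹ-refl (≈ᴹ-trans (*ᵣ-neg s y) (-ᴹ‿cong (*ᵣ-cong ≈ᴹ-refl s≈t)))))
                (act-closed s d)
            ; *ᵣ-zeroʳ     = λ x → ≈⇒∼ X-sub (*ᵣ-zeroʳ x)
            ; *ᵣ-distribˡ  = λ x s t → ≈⇒∼ X-sub (*ᵣ-distribˡ x s t)
            ; *ᵣ-identityʳ = λ x → ≈⇒∼ X-sub (*ᵣ-identityʳ x)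
            ; *ᵣ-assoc     = λ x s t → ≈⇒∼ X-sub (*ᵣ-assoc x s t)
            ; *ᵣ-zeroˡ     = λ s → ≈⇒∼ X-sub (*ᵣ-zeroˡ s)
            ; *ᵣ-distribʳ  = λ s x y → ≈⇒∼ X-sub (*ᵣ-distribʳ s x y)
            }
          }
        ; -ᴹ‿cong    = IsAbelianGroup.⁻¹-cong Q
        ; -ᴹ‿inverse = IsAbelianGroup.inverse Q
        }
      } where
        open IsSubmodule X-sub
        Q = ∼-isAbelianGroup X-sub
        *ᵣ-neg : ∀ s x → (-ᴹ x) *ᵣ s ≈ᴹ -ᴹ (x *ᵣ s)
        *ᵣ-neg s x = inverseʳ-unique (x *ᵣ s) ((-ᴹ x) *ᵣ s)
          (≈ᴹ-trans (≈ᴹ-sym (*ᵣ-distribʳ s x (-ᴹ x)))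
            (≈ᴹ-trans (*ᵣ-cong (-ᴹ‿inverseʳ x) (Ring.refl R)) (*ᵣ-zeroˡ s)))

module _ {c ℓ} (R : Ring c ℓ) where

  open Ring R
  private
    module RP = RingProperties R
    Rₗ = TensorUnit.leftModule {R = R}
    Rᵣ = TensorUnit.rightModule {R = R}
    module L = LeftSubmodules Rₗ
    module Rt = RightSubmodules Rᵣ
    open SetoidReasoning setoid

  -- The Jacobson radical, as the intersection of all maximal left ideals.
  Rad : Pred Carrier (suc (c ⊔ ℓ))
  Rad x = ∀ {I : Pred Carrier (c ⊔ ℓ)} → L.IsMaximal I → x ∈ I

  Rad-isLeftIdeal : L.IsSubmodule Rad
  Rad-isLeftIdeal = record
    { resp       = λ x≈y x∈ I → sub.resp I x≈y (x∈ I)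
    ; 0-closed   = λ I → sub.0-closed I
    ; +-closed   = λ x∈ y∈ I → sub.+-closed I (x∈ I) (y∈ I)
    ; neg-closed = λ x∈ I → sub.neg-closed I (x∈ I)
    ; act-closed = λ s x∈ I → sub.act-closed I s (x∈ I)
    }
    where module sub {I : Pred Carrier (c ⊔ ℓ)} (max : L.IsMaximal I) =
            L.IsSubmodule (L.IsMaximal.isSubmodule max)

  private
    unit⇒universal : ∀ {p} {I : Pred Carrier p} → L.IsSubmodule I → 1# ∈ I → Universal I
    unit⇒universal sub 1∈I x = resp (*-identityʳ x) (act-closed x 1∈I)
      where open L.IsSubmodule sub

    module Maximal {I : Pred Carrier (c ⊔ ℓ)} (max : L.IsMaximal I) where

      open L.IsMaximal max
      open L.IsSubmodule isSubmodule

      stable : ∀ {x} → ¬ ¬ x ∈ I → x ∈ I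
      stable = maximal
        (record
          { resp       = λ x≈y ¬¬x ¬y → ¬¬x (λ x → ¬y (resp x≈y x))
          ; 0-closed   = λ ¬0 → ¬0 0-closed
          ; +-closed   = λ ¬¬x ¬¬y ¬xy → ¬¬x (λ x → ¬¬y (λ y → ¬xy (+-closed x y)))
          ; neg-closed = λ ¬¬x ¬-x → ¬¬x (λ x → ¬-x (neg-closed x))
          ; act-closed = λ s ¬¬x ¬sx → ¬¬x (λ x → ¬sx (act-closed s x))
          })
        (λ x∈I x∉I → x∉I x∈I)
        (λ univ → univ 1# (λ 1∈I → proper (unit⇒universal isSubmodule 1∈I)))

      -- (I : r)
      colon : Carrier → Pred Carrier (c ⊔ ℓ)
      colon r x = x * r ∈ I

      colon-isSubmodule : ∀ r → L.IsSubmodule (colon r)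
      colon-isSubmodule r = record
        { resp       = λ x≈y → resp (*-congʳ x≈y)
        ; 0-closed   = resp (sym (zeroˡ r)) 0-closed
        ; +-closed   = λ {x} {y} x∈ y∈ → resp (sym (distribʳ r x y)) (+-closed x∈ y∈)
        ; neg-closed = λ {x} x∈ → resp (RP.-‿distribˡ-* x r) (neg-closed x∈)
        ; act-closed = λ s {x} x∈ → resp (sym (*-assoc s x r)) (act-closed s x∈)
        }

      -- I + Ra
      adjoin : Carrier → Pred Carrier (c ⊔ ℓ)
      adjoin a z = ∃₂ λ i s → i ∈ I × z ≈ i + s * a

      adjoin-isSubmodule : ∀ a → L.IsSubmodule (adjoin a)
      adjoin-isSubmodule a = record
        { resp       = λ x≈y (i , s , i∈I , eq) → i , s , i∈I , trans (sym x≈y) eq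
        ; 0-closed   = 0# , 0# , 0-closed ,
                       sym (trans (+-identityˡ _) (zeroˡ a))
        ; +-closed   = λ {x} {y} (i , s , i∈I , eq) (j , t , j∈I , eq′) →
                       i + j , s + t , +-closed i∈I j∈I , (begin
                         x + y                       ≈⟨ +-cong eq eq′ ⟩
                         (i + s * a) + (j + t * a)   ≈⟨ +-assoc _ _ _ ⟩
                         i + (s * a + (j + t * a))   ≈⟨ +-congˡ (+-assoc _ _ _) ⟨
                         i + ((s * a + j) + t * a)   ≈⟨ +-congˡ (+-congʳ (+-comm _ _)) ⟩
                         i + ((j + s * a) + t * a)   ≈⟨ +-congˡ (+-assoc _ _ _) ⟩
                         i + (j + (s * a + t * a))   ≈⟨ +-assoc _ _ _ ⟨
                         (i + j) + (s * a + t * a)   ≈⟨ +-congˡ (distribʳ a s t) ⟨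
                         (i + j) + (s + t) * a       ∎)
        ; neg-closed = λ {x} (i , s , i∈I , eq) → - i , - s , neg-closed i∈I , (begin
                         - x                ≈⟨ -‿cong eq ⟩
                         - (i + s * a)      ≈⟨ RP.-‿+-comm i (s * a) ⟨
                         - i + - (s * a)    ≈⟨ +-congˡ (RP.-‿distribˡ-* s a) ⟩
                         - i + (- s) * a    ∎)
        ; act-closed = λ t {x} (i , s , i∈I , eq) → t * i , t * s , act-closed t i∈I , (begin
                         t * x                ≈⟨ *-congˡ eq ⟩
                         t * (i + s * a)      ≈⟨ distribˡ t i (s * a) ⟩
                         t * i + t * (s * a)  ≈⟨ +-congˡ (*-assoc t s a) ⟨
                         t * i + (t * s) * a  ∎)
        }

      colon-isMaximal : ∀ {r} → r ∉ I → L.IsMaximal (colon r)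
      colon-isMaximal {r} r∉I = record
        { isSubmodule = colon-isSubmodule r
        ; proper      = λ univ → r∉I (resp (*-identityˡ r) (univ 1#))
        ; maximal     = λ {N} N-sub I⊆N N-proper {n} n∈N → stable λ nr∉I →
            let module N = L.IsSubmodule N-sub
                a = n * r

                a∈ : a ∈ adjoin a
                a∈ = 0# , 1# , 0-closed , sym (trans (+-identityˡ _) (*-identityˡ a))

                ¬univ : ¬ Universal (adjoin a)
                ¬univ univ =
                  let (i , s , i∈I , eq) = univ r
                      1-sn∈I : (1# + (- s) * n) * r ∈ I
                      1-sn∈I = resp (sym (begin
                        (1# + (- s) * n) * r         ≈⟨ distribʳ r 1# _ ⟩
                        1# * r + (- s) * n * r       ≈⟨ +-cong (*-identityˡ r) (*-assoc _ n r) ⟩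
                        r + (- s) * a                ≈⟨ +-cong eq (sym (RP.-‿distribˡ-* s a)) ⟩
                        (i + s * a) + - (s * a)      ≈⟨ +-assoc i _ _ ⟩
                        i + (s * a + - (s * a))      ≈⟨ +-congˡ (-‿inverseʳ _) ⟩
                        i + 0#                       ≈⟨ +-identityʳ i ⟩
                        i                            ∎)) i∈I
                  in N-proper (unit⇒universal N-sub (N.resp (begin
                        (1# + (- s) * n) + s * n     ≈⟨ +-assoc 1# _ _ ⟩
                        1# + ((- s) * n + s * n)     ≈⟨ +-congˡ (distribʳ n (- s) s) ⟨
                        1# + (- s + s) * n           ≈⟨ +-congˡ (*-congʳ (-‿inverseˡ s)) ⟩
                        1# + 0# * n                  ≈⟨ +-congˡ (zeroˡ n) ⟩
                        1# + 0#                      ≈⟨ +-identityʳ 1# ⟩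
                        1#                           ∎)
                      (N.+-closed (I⊆N 1-sn∈I) (N.act-closed s n∈N))))
            in nr∉I (maximal (adjoin-isSubmodule a)
                 (λ {z} z∈I → z , 0# , z∈I , sym (trans (+-congˡ (zeroˡ a)) (+-identityʳ z)))
                 ¬univ a∈)
        }

  Rad-isRightIdeal : Rt.IsSubmodule Rad
  Rad-isRightIdeal = record
    { resp       = resp
    ; 0-closed   = 0-closed
    ; +-closed   = +-closed
    ; neg-closed = neg-closed
    ; act-closed = λ r {x} x∈Rad {I} max → Maximal.stable max λ xr∉I →
        xr∉I (x∈Rad (Maximal.colon-isMaximal max λ r∈I →
          xr∉I (L.IsSubmodule.act-closed (L.IsMaximal.isSubmodule max) x r∈I)))
    }
    where open L.IsSubmodule Rad-isLeftIdeal

  leftSocle-isLeftIdeal : L.IsSubmodule L.Socle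
  leftSocle-isLeftIdeal = record
    { resp       = L.equal
    ; 0-closed   = L.zero
    ; +-closed   = L.plus
    ; neg-closed = neg
    ; act-closed = act
    }
    where
      act : ∀ s {x} → x ∈ L.Socle → s * x ∈ L.Socle
      act s (L.simple S x∈S)        = L.simple S (L.IsSubmodule.act-closed (L.IsSimple.isSubmodule S) s x∈S)
      act s L.zero                  = L.equal (sym (zeroʳ s)) L.zero
      act s (L.plus {x} {y} x∈ y∈)  = L.equal (sym (distribˡ s x y)) (L.plus (act s x∈) (act s y∈))
      act s (L.equal x≈y x∈)        = L.equal (*-congˡ x≈y) (act s x∈)

      neg : ∀ {x} → x ∈ L.Socle → - x ∈ L.Socle
      neg {x} x∈ = L.equal (RP.-1*x≈-x x) (act (- 1#) x∈)

  rightSocle-isRightIdeal : Rt.IsSubmodule Rt.Socle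
  rightSocle-isRightIdeal = record
    { resp       = Rt.equal
    ; 0-closed   = Rt.zero
    ; +-closed   = Rt.plus
    ; neg-closed = neg
    ; act-closed = act
    }
    where
      act : ∀ s {x} → x ∈ Rt.Socle → x * s ∈ Rt.Socle
      act s (Rt.simple S x∈S)       = Rt.simple S (Rt.IsSubmodule.act-closed (Rt.IsSimple.isSubmodule S) s x∈S)
      act s Rt.zero                 = Rt.equal (sym (zeroˡ s)) Rt.zero
      act s (Rt.plus {x} {y} x∈ y∈) = Rt.equal (sym (distribʳ s x y)) (Rt.plus (act s x∈) (act s y∈))
      act s (Rt.equal x≈y x∈)       = Rt.equal (*-congʳ x≈y) (act s x∈)

      neg : ∀ {x} → x ∈ Rt.Socle → - x ∈ Rt.Socle
      neg {x} x∈ = Rt.equal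
        (trans (sym (RP.-‿distribʳ-* x 1#)) (-‿cong (*-identityʳ x))) (act (- 1#) x∈)

  record IsFrobenius : Set (suc (c ⊔ ℓ)) where
    field
      right : rightQuotient Rᵣ Rad-isRightIdeal ≅ᵣ rightSubmodule Rᵣ rightSocle-isRightIdeal
      left  : leftQuotient  Rₗ Rad-isLeftIdeal  ≅ₗ leftSubmodule  Rₗ leftSocle-isLeftIdeal

permutationSetoid : ℕ → Setoid _ _
permutationSetoid n = record
  { Carrier       = Permutation′ n
  ; _≈_           = Perm._≈_
  ; isEquivalence = record
    { refl  = λ _ → ≡.refl
    ; sym   = λ p i → ≡.sym (p i)
    ; trans = λ p q i → ≡.trans (p i) (q i)
    }
  }

-- `g ∘ₚ h` applies g first, which is the product gh for permutations acting on
-- the right of coordinates.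
record PermutationGroup (n : ℕ) (p : Level) : Set (suc p) where
  field
    Member    : Pred (Permutation′ n) p
    resp      : Member Respects Perm._≈_
    id∈       : Perm.id ∈ Member
    ∘-closed  : ∀ {g h} → g ∈ Member → h ∈ Member → g ∘ₚ h ∈ Member
    ⁻¹-closed : ∀ {g} → g ∈ Member → Perm.flip g ∈ Member
    finite    : IsFinite (On.setoid (permutationSetoid n) (proj₁ {B = Member}))

  open IsFinite finite public using (enumeration) renaming (size to order)

  element : Fin order → Permutation′ n
  element i = proj₁ (Inverse.from enumeration i)

_≤ᴳ_ : ∀ {n p q} → PermutationGroup n p → PermutationGroup n q → Set _
H ≤ᴳ G = PermutationGroup.Member H ⊆ PermutationGroup.Member G

module Codes {c ℓ} (R : Ring c ℓ) (n : ℕ) where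

  open Ring R using (Carrier; _≈_; _*_; 0#; 1#; +-rawMonoid; +-abelianGroup;
    *-cong; zeroˡ; zeroʳ; distribˡ; distribʳ; *-identityˡ; *-assoc)

  V : LeftModule R c ℓ
  V = record
    { _*ₗ_         = λ r v i → r * v i
    ; isLeftModule = record
      { isLeftSemimodule = record
        { +ᴹ-isCommutativeMonoid = AbelianGroup.isCommutativeMonoid Rⁿ
        ; isPreleftSemimodule = record
          { *ₗ-cong      = λ r≈s v≈w i → *-cong r≈s (v≈w i)
          ; *ₗ-zeroˡ     = λ v i → zeroˡ (v i)
          ; *ₗ-distribʳ  = λ v r s i → distribʳ (v i) r s
          ; *ₗ-identityˡ = λ v i → *-identityˡ (v i)
          ; *ₗ-assoc     = λ r s v i → *-assoc r s (v i)
          ; *ₗ-zeroʳ     = λ r i → zeroʳ r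
          ; *ₗ-distribˡ  = λ r v w i → distribˡ r (v i) (w i)
          }
        }
      ; -ᴹ‿cong    = AbelianGroup.⁻¹-cong Rⁿ
      ; -ᴹ‿inverse = AbelianGroup.inverse Rⁿ
      }
    } where Rⁿ = Pointwise.abelianGroup (Fin n) +-abelianGroup

  open LeftModule V using (_≈ᴹ_; 0ᴹ; _*ₗ_; +ᴹ-rawMonoid)
  open LeftSubmodules V public using (IsSubmodule; IsInternalDirectSum)
  private
    module ΣR = RawMonoidDefs +-rawMonoid
    module ΣV = RawMonoidDefs +ᴹ-rawMonoid

  ⟨_,_⟩ : Vector Carrier n → Vector Carrier n → Carrier
  ⟨ u , v ⟩ = ΣR.sum (λ i → u i * v i)

  infixl 7 _·_
  _·_ : Vector Carrier n → Permutation′ n → Vector Carrier n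
  (v · g) i = v (g ⟨$⟩ˡ i)

  record IsLeftCode {g p} (G : PermutationGroup n g) (C : Pred (Vector Carrier n) p)
                    : Set (c ⊔ ℓ ⊔ g ⊔ p) where
    field
      isSubmodule : IsSubmodule C
      ·-closed    : ∀ {g} → g ∈ PermutationGroup.Member G → ∀ {v} → v ∈ C → v · g ∈ C

  ⊥ˡ : ∀ {p} → Pred (Vector Carrier n) p → Pred (Vector Carrier n) (c ⊔ ℓ ⊔ p)
  ⊥ˡ X u = ∀ {v} → v ∈ X → ⟨ u , v ⟩ ≈ 0#

  HasInvertibleOrder : ∀ {h} → PermutationGroup n h → Set (c ⊔ ℓ)
  HasInvertibleOrder H = Invertible _≈_ 1# _*_ (PermutationGroup.order H ΣR.× 1#)

  θ : ∀ {h} (H : PermutationGroup n h) → HasInvertibleOrder H →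
      Vector Carrier n → Vector Carrier n
  θ H (|H|⁻¹ , _) v = |H|⁻¹ *ₗ ΣV.sum (λ k → v · PermutationGroup.element H k)

  image : ∀ {p} → (Vector Carrier n → Vector Carrier n) →
          Pred (Vector Carrier n) p → Pred (Vector Carrier n) (c ⊔ ℓ ⊔ p)
  image f X w = ∃[ v ] v ∈ X × w ≈ᴹ f v

  ker : (Vector Carrier n → Vector Carrier n) → Pred (Vector Carrier n) ℓ
  ker f v = f v ≈ᴹ 0ᴹ

{-# OPTIONS --safe #-}

-- Reindexing the sum over H by inversion makes θ_H self-adjoint for (u , v), so
-- u lies in ⊥(Cθ) exactly when uθ lies in ⊥C. Reindexing it by translations
-- makes θ_H idempotent, so u = (u − uθ) + (uθ)θ splits such a u into an element
-- of ker θ and one of (⊥C)θ. Conversely (⊥C)θ is orthogonal to Cθ, because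
-- Cθ ⊆ C when C is invariant under H.

module Submission where

open import Defs
open import Algebra.Bundles using (Ring)
open import Algebra.Module.Bundles using (LeftModule)
import Algebra.Properties.Ring as RingProperties
import Algebra.Properties.Semiring.Mult as Mult
import Algebra.Properties.Semiring.Sum as Sum
open import Data.Fin.Base using (zero; suc)
import Data.Fin.Permutation as Perm
open Perm using (Permutation′; _⟨$⟩ʳ_; _⟨$⟩ˡ_; _∘ₚ_)
open import Data.Nat.Base using (ℕ; zero; suc)
open import Data.Product.Base using (∃₂; _×_; _,_; proj₁; proj₂)
open import Data.Vec.Functional using (Vector)
open import Function.Base using (_∘_)
open import Function.Bundles using (Inverse)
import Function.Construct.Composition as Composition
import Function.Construct.Symmetry as Symmetry
open import Level using (Level)
open import Relation.Binary.Bundles using (Setoid)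
import Relation.Binary.Construct.On as On
open import Relation.Binary.Definitions using (_Respects_)
open import Relation.Binary.PropositionalEquality as ≡ using (_≡_)
import Relation.Binary.Reasoning.Setoid as SetoidReasoning
open import Relation.Unary using (Pred; _∈_)

-- Bijections of a permutation group onto itself.

private
  variable
    n : ℕ

-- `Perm._≈_` compares only the maps `⟨$⟩ʳ`, while `_·_` reads coordinates through `⟨$⟩ˡ`. The two
-- inverses agree because `h` and `g` have the same value at `h ⟨$⟩ˡ i`.
⟨$⟩ˡ-cong : ∀ {g h : Permutation′ n} → g Perm.≈ h → ∀ i → g ⟨$⟩ˡ i ≡ h ⟨$⟩ˡ i
⟨$⟩ˡ-cong {g = g} {h} g≈h i = begin
  g ⟨$⟩ˡ i                        ≡⟨ ≡.cong (g ⟨$⟩ˡ_) (Perm.inverseʳ h) ⟨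
  g ⟨$⟩ˡ (h ⟨$⟩ʳ (h ⟨$⟩ˡ i))      ≡⟨ ≡.cong (g ⟨$⟩ˡ_) (g≈h (h ⟨$⟩ˡ i)) ⟨
  g ⟨$⟩ˡ (g ⟨$⟩ʳ (h ⟨$⟩ˡ i))      ≡⟨ Perm.inverseˡ g ⟩
  h ⟨$⟩ˡ i                        ∎
  where open ≡.≡-Reasoning

module _ {h} (H : PermutationGroup n h) where

  open PermutationGroup H

  memberSetoid : Setoid _ _
  memberSetoid = On.setoid (permutationSetoid n) (proj₁ {B = Member})

  -- The translation is on the right because `(x ∘ₚ g) ⟨$⟩ˡ i` computes to `x ⟨$⟩ˡ (g ⟨$⟩ˡ i)`, the
  -- index that arises when `g` acts on `v · x`.
  rightTranslation : ∀ {g} → g ∈ Member → Inverse memberSetoid memberSetoid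
  rightTranslation {g} g∈H = record
    { to        = λ (x , x∈H) → x ∘ₚ g , ∘-closed x∈H g∈H
    ; from      = λ (x , x∈H) → x ∘ₚ Perm.flip g , ∘-closed x∈H (⁻¹-closed g∈H)
    ; to-cong   = λ x≈y i → ≡.cong (g ⟨$⟩ʳ_) (x≈y i)
    ; from-cong = λ x≈y i → ≡.cong (g ⟨$⟩ˡ_) (x≈y i)
    ; inverse   = (λ y≈ i → ≡.trans (≡.cong (g ⟨$⟩ʳ_) (y≈ i)) (Perm.inverseʳ g))
                , (λ y≈ i → ≡.trans (≡.cong (g ⟨$⟩ˡ_) (y≈ i)) (Perm.inverseˡ g))
    }

  inversion : Inverse memberSetoid memberSetoid
  inversion = record
    { to        = invert
    ; from      = invert
    ; to-cong   = λ {x} {y} → invert-cong {x} {y}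
    ; from-cong = λ {x} {y} → invert-cong {x} {y}
    -- `Perm.flip` swaps the two maps, so `invert (invert x)` computes to the maps of `x`, and both
    -- inverse laws are instances of congruence.
    ; inverse   = (λ {x} {y} → invert-cong {y} {invert x})
                , (λ {x} {y} → invert-cong {y} {invert x})
    }
    where
      open Setoid memberSetoid using (Carrier; _≈_)

      invert : Carrier → Carrier
      invert (x , x∈H) = Perm.flip x , ⁻¹-closed x∈H

      invert-cong : ∀ {x y} → x ≈ y → invert x ≈ invert y
      invert-cong {x , _} {y , _} = ⟨$⟩ˡ-cong {g = x} {y}

-- Central scalars and reindexed sums over a group.

module _ {c ℓ} (R : Ring c ℓ) where

  open Ring R hiding (zero)
  open RingProperties R using (-1*x≈-x)
  open Sum semiring using (sum; sum-cong-≋; sum-replicate; sum-permute;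
    ∑-distrib-+; ∑-comm; *-distribˡ-sum; *-distribʳ-sum)
  open Mult semiring using (×-assoc-*; ×-comm-*; ×-congʳ) renaming (_×_ to _×ᴿ_)
  open SetoidReasoning setoid

  -- `R` may be noncommutative, but multiplying by `k ×ᴿ 1#` on either side adds up `k` copies of
  -- `x`.
  ×1-central : ∀ k x → (k ×ᴿ 1#) * x ≈ x * (k ×ᴿ 1#)
  ×1-central k x = begin
    (k ×ᴿ 1#) * x    ≈⟨ ×-assoc-* k 1# x ⟩
    k ×ᴿ (1# * x)    ≈⟨ ×-congʳ k (trans (*-identityˡ x) (sym (*-identityʳ x))) ⟩
    k ×ᴿ (x * 1#)    ≈⟨ ×-comm-* k x 1# ⟨
    x * (k ×ᴿ 1#)    ∎

  -- Insert `z * z⁻¹` after `x`, carry `z` across `x` by its centrality, and cancel it on the left.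
  -- This makes the scalar of `θ` central.
  inverse-central : ∀ {z z⁻¹} → z⁻¹ * z ≈ 1# → z * z⁻¹ ≈ 1# →
                    (∀ x → z * x ≈ x * z) → ∀ x → z⁻¹ * x ≈ x * z⁻¹
  inverse-central {z} {z⁻¹} invˡ invʳ central x = begin
    z⁻¹ * x                  ≈⟨ *-congˡ (*-identityʳ x) ⟨
    z⁻¹ * (x * 1#)           ≈⟨ *-congˡ (*-congˡ invʳ) ⟨
    z⁻¹ * (x * (z * z⁻¹))    ≈⟨ *-congˡ (*-assoc x z z⁻¹) ⟨
    z⁻¹ * ((x * z) * z⁻¹)    ≈⟨ *-congˡ (*-congʳ (central x)) ⟨
    z⁻¹ * ((z * x) * z⁻¹)    ≈⟨ *-congˡ (*-assoc z x z⁻¹) ⟩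
    z⁻¹ * (z * (x * z⁻¹))    ≈⟨ *-assoc z⁻¹ z (x * z⁻¹) ⟨
    (z⁻¹ * z) * (x * z⁻¹)    ≈⟨ *-congʳ invˡ ⟩
    1# * (x * z⁻¹)           ≈⟨ *-identityˡ (x * z⁻¹) ⟩
    x * z⁻¹                  ∎

  module _ {h} (H : PermutationGroup n h) where

    open PermutationGroup H

    -- Conjugating `φ` by the enumeration gives a permutation of the indices. The round trip through
    -- the enumeration returns a permutation only up to `Perm._≈_`, hence `f-cong`.
    sum-reindex : (φ : Inverse (memberSetoid H) (memberSetoid H))
                  (f : Permutation′ n → Carrier) → (∀ {x y} → x Perm.≈ y → f x ≈ f y) →
                  sum (f ∘ element) ≈
                  sum (λ k → f (proj₁ (Inverse.to φ (Inverse.from enumeration k))))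
    sum-reindex φ f f-cong = trans (sum-permute (f ∘ element) π) (sum-cong-≋ λ k →
      f-cong (Inverse.strictlyInverseʳ enumeration
        (Inverse.to φ (Inverse.from enumeration k))))
      where
        π : Permutation′ order
        π = Composition.inverse (Symmetry.inverse enumeration)
              (Composition.inverse φ enumeration)

  -- The bilinear form and submodules of `V`.

  module _ (n : ℕ) where

    open Codes R n
    open LeftModule V using (_≈ᴹ_; 0ᴹ; _+ᴹ_; _*ₗ_; +ᴹ-rawMonoid)
    open import Algebra.Definitions.RawMonoid +ᴹ-rawMonoid using () renaming (sum to sumᴹ)

    sumᴹ-lookup : ∀ {k} (f : Vector (Vector Carrier n) k) i → sumᴹ f i ≈ sum (λ j → f j i)
    sumᴹ-lookup {zero}  f i = refl
    sumᴹ-lookup {suc k} f i = +-congˡ (sumᴹ-lookup (f ∘ suc) i)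

    sumᴹ-closed : ∀ {p} {X : Pred (Vector Carrier n) p} → IsSubmodule X →
                  ∀ {k} {f : Vector (Vector Carrier n) k} → (∀ j → f j ∈ X) → sumᴹ f ∈ X
    sumᴹ-closed X-sub {zero}  f∈X = IsSubmodule.0-closed X-sub
    sumᴹ-closed X-sub {suc k} f∈X =
      IsSubmodule.+-closed X-sub (f∈X zero) (sumᴹ-closed X-sub (f∈X ∘ suc))

    ⟨⟩-cong : ∀ {u u′ v v′} → u ≈ᴹ u′ → v ≈ᴹ v′ → ⟨ u , v ⟩ ≈ ⟨ u′ , v′ ⟩
    ⟨⟩-cong u≈u′ v≈v′ = sum-cong-≋ λ i → *-cong (u≈u′ i) (v≈v′ i)

    ⟨⟩-+ˡ : ∀ u w v → ⟨ u +ᴹ w , v ⟩ ≈ ⟨ u , v ⟩ + ⟨ w , v ⟩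
    ⟨⟩-+ˡ u w v = trans (sum-cong-≋ λ i → distribʳ (v i) (u i) (w i))
                        (∑-distrib-+ (λ i → u i * v i) (λ i → w i * v i))

    ⟨⟩-*ˡ : ∀ r u v → ⟨ r *ₗ u , v ⟩ ≈ r * ⟨ u , v ⟩
    ⟨⟩-*ˡ r u v = trans (sum-cong-≋ λ i → *-assoc r (u i) (v i))
                        (sym (*-distribˡ-sum r (λ i → u i * v i)))

    -- Substituting `g ⟨$⟩ʳ i` for the summation index moves `g` to the other argument as its
    -- inverse: the right side is `⟨ u · Perm.flip g , v ⟩`.
    ⟨⟩-·ʳ : ∀ u v (g : Permutation′ n) → ⟨ u , v · g ⟩ ≈ sum (λ i → u (g ⟨$⟩ʳ i) * v i)
    ⟨⟩-·ʳ u v g = begin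
      sum (λ i → u i * v (g ⟨$⟩ˡ i))
        ≈⟨ sum-permute (λ i → u i * v (g ⟨$⟩ˡ i)) g ⟩
      sum (λ i → u (g ⟨$⟩ʳ i) * v (g ⟨$⟩ˡ (g ⟨$⟩ʳ i)))
        ≈⟨ sum-cong-≋ {n} (λ i → *-congˡ (reflexive (≡.cong v (Perm.inverseˡ g {i})))) ⟩
      sum (λ i → u (g ⟨$⟩ʳ i) * v i)
        ∎

    isSubmodule : ∀ {p} {X : Pred (Vector Carrier n) p} →
                  X Respects _≈ᴹ_ → 0ᴹ ∈ X → (∀ {x y} → x ∈ X → y ∈ X → x +ᴹ y ∈ X) →
                  (∀ s {x} → x ∈ X → s *ₗ x ∈ X) → IsSubmodule X
    isSubmodule resp 0-closed +-closed act-closed = record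
      { resp       = resp
      ; 0-closed   = 0-closed
      ; +-closed   = +-closed
      ; neg-closed = λ {x} x∈X → resp (λ i → -1*x≈-x (x i)) (act-closed (- 1#) x∈X)
      ; act-closed = act-closed
      }

    -- Left scalars pull out of the first argument of the form, so annihilators on this side are
    -- left submodules.
    ⊥ˡ-isSubmodule : ∀ {p} {X : Pred (Vector Carrier n) p} → IsSubmodule (⊥ˡ X)
    ⊥ˡ-isSubmodule = isSubmodule
      (λ x≈y x⊥ v∈X → trans (⟨⟩-cong (λ i → sym (x≈y i)) (λ _ → refl)) (x⊥ v∈X))
      (λ {v} _ → begin
        ⟨ 0ᴹ , v ⟩          ≈⟨ ⟨⟩-cong {v = v} (λ _ → zeroˡ 0#) (λ _ → refl) ⟨
        ⟨ 0# *ₗ 0ᴹ , v ⟩    ≈⟨ ⟨⟩-*ˡ 0# 0ᴹ v ⟩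
        0# * ⟨ 0ᴹ , v ⟩     ≈⟨ zeroˡ _ ⟩
        0#                  ∎)
      (λ {x} {y} x⊥ y⊥ {v} v∈X →
        trans (⟨⟩-+ˡ x y v) (trans (+-cong (x⊥ v∈X) (y⊥ v∈X)) (+-identityˡ 0#)))
      (λ s {x} x⊥ {v} v∈X → trans (⟨⟩-*ˡ s x v) (trans (*-congˡ (x⊥ v∈X)) (zeroʳ s)))

    module _ {f : Vector Carrier n → Vector Carrier n}
             (f-cong : ∀ {v w} → v ≈ᴹ w → f v ≈ᴹ f w)
             (f-+ : ∀ v w → f (v +ᴹ w) ≈ᴹ f v +ᴹ f w)
             (f-* : ∀ r v → f (r *ₗ v) ≈ᴹ r *ₗ f v) where

      private
        f-0 : f 0ᴹ ≈ᴹ 0ᴹ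
        f-0 i = begin
          f 0ᴹ i           ≈⟨ f-cong (λ _ → zeroˡ 0#) i ⟨
          f (0# *ₗ 0ᴹ) i   ≈⟨ f-* 0# 0ᴹ i ⟩
          0# * f 0ᴹ i      ≈⟨ zeroˡ _ ⟩
          0#               ∎

      ker-isSubmodule : IsSubmodule (ker f)
      ker-isSubmodule = isSubmodule
        (λ x≈y fx≈0 i → trans (sym (f-cong x≈y i)) (fx≈0 i))
        f-0
        (λ {x} {y} fx≈0 fy≈0 i →
          trans (f-+ x y i) (trans (+-cong (fx≈0 i) (fy≈0 i)) (+-identityˡ 0#)))
        (λ s {x} fx≈0 i → trans (f-* s x i) (trans (*-congˡ (fx≈0 i)) (zeroʳ s)))

      image-isSubmodule : ∀ {p} {X : Pred (Vector Carrier n) p} →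
                          IsSubmodule X → IsSubmodule (image f X)
      image-isSubmodule X-sub = isSubmodule
        (λ x≈y (v , v∈X , x≈fv) → v , v∈X , λ i → trans (sym (x≈y i)) (x≈fv i))
        (0ᴹ , X.0-closed , λ i → sym (f-0 i))
        (λ (v , v∈X , x≈fv) (w , w∈X , y≈fw) → v +ᴹ w , X.+-closed v∈X w∈X ,
          λ i → trans (+-cong (x≈fv i) (y≈fw i)) (sym (f-+ v w i)))
        (λ s (v , v∈X , x≈fv) → s *ₗ v , X.act-closed s v∈X ,
          λ i → trans (*-congˡ (x≈fv i)) (sym (f-* s v i)))
        where module X = IsSubmodule X-sub

    -- The averaging operator.

    module _ {h} (H : PermutationGroup n h) (|H|-inv : HasInvertibleOrder H) where

      open PermutationGroup H using (Member; order; element; enumeration)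

      private
        m : Carrier
        m = proj₁ |H|-inv

        θᴴ : Vector Carrier n → Vector Carrier n
        θᴴ = θ H |H|-inv

        m-inverse : m * (order ×ᴿ 1#) ≈ 1#
        m-inverse = proj₁ (proj₂ |H|-inv)

        m-central : ∀ x → m * x ≈ x * m
        m-central = inverse-central m-inverse (proj₂ (proj₂ |H|-inv)) (×1-central order)

        element∈H : ∀ k → element k ∈ Member
        element∈H k = proj₂ (Inverse.from enumeration k)

      θ-lookup : ∀ v i → θᴴ v i ≈ m * sum (λ k → v (element k ⟨$⟩ˡ i))
      θ-lookup v i = *-congˡ (sumᴹ-lookup (λ k → v · element k) i)

      θ-cong : ∀ {v w} → v ≈ᴹ w → θᴴ v ≈ᴹ θᴴ w
      θ-cong {v} {w} v≈w i = begin
        θᴴ v i                                   ≈⟨ θ-lookup v i ⟩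
        m * sum (λ k → v (element k ⟨$⟩ˡ i))     ≈⟨ *-congˡ (sum-cong-≋ λ k → v≈w (element k ⟨$⟩ˡ i)) ⟩
        m * sum (λ k → w (element k ⟨$⟩ˡ i))     ≈⟨ θ-lookup w i ⟨
        θᴴ w i                                   ∎

      θ-+ : ∀ v w → θᴴ (v +ᴹ w) ≈ᴹ θᴴ v +ᴹ θᴴ w
      θ-+ v w i = begin
        θᴴ (v +ᴹ w) i         ≈⟨ θ-lookup (v +ᴹ w) i ⟩
        m * sum (λ k → v (element k ⟨$⟩ˡ i) + w (element k ⟨$⟩ˡ i))
                              ≈⟨ *-congˡ (∑-distrib-+ (λ k → v (element k ⟨$⟩ˡ i)) _) ⟩
        m * (sum (λ k → v (element k ⟨$⟩ˡ i)) + sum (λ k → w (element k ⟨$⟩ˡ i)))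
                              ≈⟨ distribˡ m _ _ ⟩
        m * sum (λ k → v (element k ⟨$⟩ˡ i)) + m * sum (λ k → w (element k ⟨$⟩ˡ i))
                              ≈⟨ +-cong (θ-lookup v i) (θ-lookup w i) ⟨
        θᴴ v i + θᴴ w i       ∎

      θ-* : ∀ r v → θᴴ (r *ₗ v) ≈ᴹ r *ₗ θᴴ v
      θ-* r v i = begin
        θᴴ (r *ₗ v) i                                  ≈⟨ θ-lookup (r *ₗ v) i ⟩
        m * sum (λ k → r * v (element k ⟨$⟩ˡ i))       ≈⟨ *-congˡ (*-distribˡ-sum r (λ k → v (element k ⟨$⟩ˡ i))) ⟨
        m * (r * sum (λ k → v (element k ⟨$⟩ˡ i)))     ≈⟨ *-assoc m r _ ⟨
        -- Left linearity of `θ` over a noncommutative ring rests on the centrality of `m`.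
        (m * r) * sum (λ k → v (element k ⟨$⟩ˡ i))     ≈⟨ *-congʳ (m-central r) ⟩
        (r * m) * sum (λ k → v (element k ⟨$⟩ˡ i))     ≈⟨ *-assoc r m _ ⟩
        r * (m * sum (λ k → v (element k ⟨$⟩ˡ i)))     ≈⟨ *-congˡ (θ-lookup v i) ⟨
        r * θᴴ v i                                     ∎

      -- Acting by `g` replaces the summand of each `x` in `H` by that of `x ∘ₚ g`, which only
      -- permutes the summands.
      θ-invariant : ∀ {g} → g ∈ Member → ∀ v → θᴴ v · g ≈ᴹ θᴴ v
      θ-invariant {g} g∈H v i = begin
        θᴴ v (g ⟨$⟩ˡ i)                                 ≈⟨ θ-lookup v (g ⟨$⟩ˡ i) ⟩
        m * sum (λ k → v (element k ⟨$⟩ˡ (g ⟨$⟩ˡ i)))   ≈⟨ *-congˡ (sum-reindex H (rightTranslation H g∈H)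
                                                              (λ x → v (x ⟨$⟩ˡ i))
                                                              (λ {x} {y} x≈y → reflexive (≡.cong v (⟨$⟩ˡ-cong {g = x} {y} x≈y i)))) ⟨
        m * sum (λ k → v (element k ⟨$⟩ˡ i))            ≈⟨ θ-lookup v i ⟨
        θᴴ v i                                          ∎

      -- All summands equal `v`, so their sum is `order` copies of `v`, which `m` scales back to
      -- `v`.
      θ-fixes-invariants : ∀ {v} → (∀ {g} → g ∈ Member → v · g ≈ᴹ v) → θᴴ v ≈ᴹ v
      θ-fixes-invariants {v} v-inv i = begin
        θᴴ v i                                 ≈⟨ θ-lookup v i ⟩
        m * sum (λ k → v (element k ⟨$⟩ˡ i))   ≈⟨ *-congˡ (sum-cong-≋ λ k → v-inv (element∈H k) i) ⟩
        m * sum {order} (λ _ → v i)            ≈⟨ *-congˡ (sum-replicate order) ⟩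
        -- The factor `1#` turns the multiple into a product with `order ×ᴿ 1#`, which `m` inverts.
        m * (order ×ᴿ v i)                      ≈⟨ *-congˡ (×-congʳ order (*-identityˡ (v i))) ⟨
        m * (order ×ᴿ (1# * v i))               ≈⟨ *-congˡ (×-assoc-* order 1# (v i)) ⟨
        m * ((order ×ᴿ 1#) * v i)               ≈⟨ *-assoc m _ (v i) ⟨
        (m * (order ×ᴿ 1#)) * v i               ≈⟨ *-congʳ m-inverse ⟩
        1# * v i                               ≈⟨ *-identityˡ (v i) ⟩
        v i                                    ∎

      θ-idem : ∀ v → θᴴ (θᴴ v) ≈ᴹ θᴴ v
      θ-idem v = θ-fixes-invariants (λ g∈H → θ-invariant g∈H v)

      -- A vector's average is a scalar times a sum of its translates. For a code this yields the
      -- inclusion of its image under `θ` in itself.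
      θ-closed : ∀ {p} {X : Pred (Vector Carrier n) p} → IsSubmodule X →
                 (∀ {g} → g ∈ Member → ∀ {v} → v ∈ X → v · g ∈ X) →
                 ∀ {v} → v ∈ X → θᴴ v ∈ X
      θ-closed X-sub ·-closed v∈X =
        IsSubmodule.act-closed X-sub m (sumᴹ-closed X-sub λ k → ·-closed (element∈H k) v∈X)

      private
        sum-inverses : ∀ u i → sum (λ k → u (element k ⟨$⟩ʳ i)) ≈ sum (λ k → u (element k ⟨$⟩ˡ i))
        sum-inverses u i = sum-reindex H (inversion H) (λ x → u (x ⟨$⟩ʳ i))
          (λ x≈y → reflexive (≡.cong u (x≈y i)))

      -- Exchanging sums isolates one pairing per group element. There `⟨⟩-·ʳ` moves the element to
      -- `u` as its inverse, and `sum-inverses` removes the inversion because the sum runs over all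
      -- of `H`.
      θ-selfAdjoint : ∀ u v → ⟨ u , θᴴ v ⟩ ≈ ⟨ θᴴ u , v ⟩
      θ-selfAdjoint u v = begin
        sum (λ i → u i * θᴴ v i)
          ≈⟨ sum-cong-≋ (λ i → begin
               u i * θᴴ v i                                  ≈⟨ *-congˡ (θ-lookup v i) ⟩
               -- The scalar sits to the right of `u i` and must cross it before it can leave the
               -- outer sum.
               u i * (m * sum (λ k → v (element k ⟨$⟩ˡ i)))  ≈⟨ *-assoc (u i) m _ ⟨
               (u i * m) * sum (λ k → v (element k ⟨$⟩ˡ i))  ≈⟨ *-congʳ (m-central (u i)) ⟨
               (m * u i) * sum (λ k → v (element k ⟨$⟩ˡ i))  ≈⟨ *-assoc m (u i) _ ⟩
               m * (u i * sum (λ k → v (element k ⟨$⟩ˡ i)))  ≈⟨ *-congˡ (*-distribˡ-sum (u i) (λ k → v (element k ⟨$⟩ˡ i))) ⟩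
               m * sum (λ k → u i * v (element k ⟨$⟩ˡ i))    ∎) ⟩
        sum (λ i → m * sum (λ k → u i * v (element k ⟨$⟩ˡ i)))
          ≈⟨ *-distribˡ-sum m (λ i → sum (λ k → u i * v (element k ⟨$⟩ˡ i))) ⟨
        m * sum (λ i → sum (λ k → u i * v (element k ⟨$⟩ˡ i)))
          ≈⟨ *-congˡ (∑-comm (λ i k → u i * v (element k ⟨$⟩ˡ i))) ⟩
        m * sum (λ k → ⟨ u , v · element k ⟩)
          ≈⟨ *-congˡ (sum-cong-≋ λ k → ⟨⟩-·ʳ u v (element k)) ⟩
        m * sum (λ k → sum (λ i → u (element k ⟨$⟩ʳ i) * v i))
          ≈⟨ *-congˡ (∑-comm (λ k i → u (element k ⟨$⟩ʳ i) * v i)) ⟩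
        m * sum (λ i → sum (λ k → u (element k ⟨$⟩ʳ i) * v i))
          ≈⟨ *-distribˡ-sum m (λ i → sum (λ k → u (element k ⟨$⟩ʳ i) * v i)) ⟩
        sum (λ i → m * sum (λ k → u (element k ⟨$⟩ʳ i) * v i))
          ≈⟨ sum-cong-≋ (λ i → begin
               m * sum (λ k → u (element k ⟨$⟩ʳ i) * v i)    ≈⟨ *-congˡ (*-distribʳ-sum (v i) (λ k → u (element k ⟨$⟩ʳ i))) ⟨
               m * (sum (λ k → u (element k ⟨$⟩ʳ i)) * v i)  ≈⟨ *-assoc m _ (v i) ⟨
               (m * sum (λ k → u (element k ⟨$⟩ʳ i))) * v i  ≈⟨ *-congʳ (*-congˡ (sum-inverses u i)) ⟩
               (m * sum (λ k → u (element k ⟨$⟩ˡ i))) * v i  ≈⟨ *-congʳ (θ-lookup u i) ⟨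
               θᴴ u i * v i                                  ∎) ⟩
        sum (λ i → θᴴ u i * v i)
          ∎

      -- The difference of `u` and `θᴴ u` is written with the scalar `- 1#` so that `θ-*` applies to
      -- it.
      θ-kills-complement : ∀ u → θᴴ (u +ᴹ - 1# *ₗ θᴴ u) ≈ᴹ 0ᴹ
      θ-kills-complement u i = begin
        θᴴ (u +ᴹ - 1# *ₗ θᴴ u) i             ≈⟨ θ-+ u (- 1# *ₗ θᴴ u) i ⟩
        θᴴ u i + θᴴ (- 1# *ₗ θᴴ u) i         ≈⟨ +-congˡ (θ-* (- 1#) (θᴴ u) i) ⟩
        θᴴ u i + - 1# * θᴴ (θᴴ u) i          ≈⟨ +-congˡ (*-congˡ (θ-idem u i)) ⟩
        θᴴ u i + - 1# * θᴴ u i               ≈⟨ +-congˡ (-1*x≈-x (θᴴ u i)) ⟩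
        θᴴ u i + - θᴴ u i                    ≈⟨ -‿inverseʳ (θᴴ u i) ⟩
        0#                                   ∎

      -- The dual of the image of a code.

      module _ {p} {C : Pred (Vector Carrier n) p} where

        ∈⊥ˡ-image⇒θ∈⊥ˡ : ∀ {u} → u ∈ ⊥ˡ (image θᴴ C) → θᴴ u ∈ ⊥ˡ C
        ∈⊥ˡ-image⇒θ∈⊥ˡ {u} u⊥ {v} v∈C =
          trans (sym (θ-selfAdjoint u v)) (u⊥ (v , v∈C , λ _ → refl))

        θ∈⊥ˡ⇒∈⊥ˡ-image : ∀ {u} → θᴴ u ∈ ⊥ˡ C → u ∈ ⊥ˡ (image θᴴ C)
        θ∈⊥ˡ⇒∈⊥ˡ-image {u} θu⊥ {w} (v , v∈C , w≈θv) = begin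
          ⟨ u , w ⟩       ≈⟨ ⟨⟩-cong {u} (λ _ → refl) w≈θv ⟩
          ⟨ u , θᴴ v ⟩    ≈⟨ θ-selfAdjoint u v ⟩
          ⟨ θᴴ u , v ⟩    ≈⟨ θu⊥ v∈C ⟩
          0#              ∎

        ⊥ˡ-image-isInternalDirectSum : (∀ {v} → v ∈ C → θᴴ v ∈ C) →
          IsInternalDirectSum (⊥ˡ (image θᴴ C)) (ker θᴴ) (image θᴴ (⊥ˡ C))
        ⊥ˡ-image-isInternalDirectSum θC⊆C = record
          { isSubmoduleˡ = ker-isSubmodule θ-cong θ-+ θ-*
          ; isSubmoduleʳ = image-isSubmodule θ-cong θ-+ θ-* ⊥ˡ-isSubmodule
          ; isSum        = split , unsplit
          -- By idempotence `θ` fixes every vector in its image, so one that it also kills is zero.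
          ; independent  = λ {z} θz≈0 (w , _ , z≈θw) i → begin
              z i            ≈⟨ z≈θw i ⟩
              θᴴ w i         ≈⟨ θ-idem w i ⟨
              θᴴ (θᴴ w) i    ≈⟨ θ-cong z≈θw i ⟨
              θᴴ z i         ≈⟨ θz≈0 i ⟩
              0#             ∎
          }
          where
            split : ∀ {u} → u ∈ ⊥ˡ (image θᴴ C) →
                    ∃₂ λ a b → a ∈ ker θᴴ × b ∈ image θᴴ (⊥ˡ C) × u ≈ᴹ a +ᴹ b
            split {u} u⊥ = (u +ᴹ - 1# *ₗ θᴴ u) , θᴴ u , θ-kills-complement u ,
              -- The preimage offered is `θᴴ u`, not `u`: it is `θᴴ u` that is known to lie in
              -- `⊥ˡ C`.
              (θᴴ u , ∈⊥ˡ-image⇒θ∈⊥ˡ u⊥ , λ i → sym (θ-idem u i)) , λ i → sym (begin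
                (u i + - 1# * θᴴ u i) + θᴴ u i    ≈⟨ +-assoc (u i) _ _ ⟩
                u i + (- 1# * θᴴ u i + θᴴ u i)    ≈⟨ +-congˡ (+-congʳ (-1*x≈-x (θᴴ u i))) ⟩
                u i + (- θᴴ u i + θᴴ u i)         ≈⟨ +-congˡ (-‿inverseˡ (θᴴ u i)) ⟩
                u i + 0#                          ≈⟨ +-identityʳ (u i) ⟩
                u i                               ∎)

            unsplit : ∀ {u} → (∃₂ λ a b → a ∈ ker θᴴ × b ∈ image θᴴ (⊥ˡ C) × u ≈ᴹ a +ᴹ b) →
                      u ∈ ⊥ˡ (image θᴴ C)
            unsplit {u} (a , b , θa≈0 , (w , w⊥ , b≈θw) , u≈a+b) = θ∈⊥ˡ⇒∈⊥ˡ-image λ {v} v∈C → begin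
              ⟨ θᴴ u , v ⟩    ≈⟨ ⟨⟩-cong {v = v} θu≈θw (λ _ → refl) ⟩
              -- Adjointness is now used backwards: with `θ` on `v`, the second argument stays in
              -- `C`, to which `w` is orthogonal.
              ⟨ θᴴ w , v ⟩    ≈⟨ θ-selfAdjoint w v ⟨
              ⟨ w , θᴴ v ⟩    ≈⟨ w⊥ (θC⊆C v∈C) ⟩
              0#              ∎
              where
                θu≈θw : θᴴ u ≈ᴹ θᴴ w
                -- The kernel component vanishes and idempotence absorbs the second `θ`.
                θu≈θw i = begin
                  θᴴ u i              ≈⟨ θ-cong u≈a+b i ⟩
                  θᴴ (a +ᴹ b) i       ≈⟨ θ-+ a b i ⟩
                  θᴴ a i + θᴴ b i     ≈⟨ +-cong (θa≈0 i) (θ-cong b≈θw i) ⟩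
                  0# + θᴴ (θᴴ w) i    ≈⟨ +-identityˡ _ ⟩
                  θᴴ (θᴴ w) i         ≈⟨ θ-idem w i ⟩
                  θᴴ w i              ∎

theorem3p1 : ∀ {c ℓ g h p : Level} (R : Ring c ℓ) → IsFinite (Ring.setoid R) → IsFrobenius R →
    (n : ℕ) (G : PermutationGroup n g) (H : PermutationGroup n h) → H ≤ᴳ G →
    let open Codes R n in
    (|H|-inv : HasInvertibleOrder H) (C : Pred (Vector (Ring.Carrier R) n) p) → IsLeftCode G C →
    IsInternalDirectSum (⊥ˡ (image (θ H |H|-inv) C))
    (ker (θ H |H|-inv)) (image (θ H |H|-inv) (⊥ˡ C))
theorem3p1 R _ _ n G H H≤G |H|-inv C C-code =
  ⊥ˡ-image-isInternalDirectSum R n H |H|-inv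
    -- Invariance of `C` under `G` is restricted along `H≤G`, since the average runs over `H`.
    (θ-closed R n H |H|-inv isSubmodule-C (λ g∈H → ·-closed (H≤G g∈H)))
  where open Codes.IsLeftCode C-code renaming (isSubmodule to isSubmodule-C)
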